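{- Let $S_2$ be the set of all nonempty partitions of the form $[5,4^k][i,j]$ with integers $k\ge 7$ and $i,j\ge 0$. Then the family of games Queen on $S_2$ is tame but not miserable, and returnable but not forced.
   Context: A partition is a finite weakly decreasing sequence $\lambda=[\lambda_1,\ldots,\lambda_r]$ of positive integers; exponents denote repetition, so $[5,4^k]$ has one part $5$ and $k$ parts $4$; $[\,]$ is the empty partition, and $\mathbb Y^+$ is the set of nonempty partitions. For $i,j\ge 0$, $\lambda[i,j]=[\lambda_{i+1}-j,\lambda_{i+2}-j,\ldots]$ with trailing nonpositive entries removed. For a moveset $M\subseteq \mathbb Z_{\ge0}^2\setminus\{(0,0)\}$ and $\lambda\in\mathbb Y^+$, the impartial chess game $(M,\lambda)$ starts at $\lambda$, and from a position $\mu\in\mathbb Y^+$ a player may move to $\mu[i,j]$ for any $(i,j)\in M$ with $\mu[i,j]\ne[\,]$. The positions of $(M,\lambda)$ are the partitions reachable from $\lambda$ by zero or more moves. A position is terminal if it has no moves. Queen has moveset $\{(k,0):k\ge1\}\cup\{(0,k):k\ge1\}\cup\{(k,k):k\ge1\}$. The Sprague-Grundy value of a position $p$ is $\mathrm{mex}$ of the Sprague-Grundy values of the positions reachable in one move ($0$ if $p$ is terminal), where $\mathrm{mex}(S)$ is the least nonnegative integer not in $S$. The misère Grundy value is defined by the same mex recursion at non-terminal positions, but terminal positions have value $1$. A position with Sprague-Grundy value $t$ and misère Grundy value $\ell$ is called a $(t,\ell)$-position. A game is returnable if for any move from a $(0,1)$-position (resp. a $(1,0)$-position) to a non-terminal position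 $y$, there is a move from $y$ to a $(0,1)$-position (resp. to a $(1,0)$-position). A game is forced if each move from a $(0,1)$-position results in a $(1,0)$-position and each move from a $(1,0)$-position results in a $(0,1)$-position. A game is tame if it has only $(0,1)$-positions, $(1,0)$-positions, and $(k,k)$-positions with $k\ge0$. A game is miserable if for every position $x$ one of the following holds: (i) $x$ is a $(0,1)$-position or a $(1,0)$-position; (ii) there is no move from $x$ to a $(0,1)$-position or a $(1,0)$-position; (iii) there are moves from $x$ to both a $(0,1)$-position and a $(1,0)$-position. For a moveset $M$ and a set $P\subseteq\mathbb Y^+$, the family $(M,P)$ has one of these properties if $(M,\lambda)$ has it for every $\lambda\in P$, and it does not have the property if $(M,\lambda)$ fails it for at least one $\lambda\in P$. -}

module Defs where

open import Data.List.Base using (List; []; _∷_; map; drop; filter; replicate)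
open import Data.List.Relation.Unary.All using (All; []; _∷_)
import Data.List.Relation.Unary.All.Properties as All
open import Data.List.Relation.Unary.Linked using (Linked; []; [-]; _∷_; tail)
import Data.List.Relation.Unary.Linked as Linked
import Data.List.Relation.Unary.Linked.Properties as Linked
open import Data.Nat.Base using (ℕ; zero; suc; _∸_; _≤_; _<_; _≥_; z<s)
open import Data.Nat.Properties using (_<?_; ∸-monoˡ-≤; ≤-refl; ≤-trans; n≤1+n)
open import Data.Product.Base using (∃; ∃-syntax; _×_; _,_)
open import Data.Sum.Base using (_⊎_)
open import Level using (0ℓ)
open import Relation.Binary.Construct.Closure.ReflexiveTransitive using (Star)
open import Relation.Binary.PropositionalEquality.Core using (_≡_; _≢_)
open import Relation.Nullary.Negation.Core using (¬_)
open import Relation.Unary using (Pred; _⊆_)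

------------------------------------------------------------------------
-- Partitions

-- The proofs are irrelevant, so partitions with the same parts are
-- propositionally equal.
record Partition : Set where
  constructor mkPartition
  field
    parts       : List ℕ
    .decreasing : Linked _≥_ parts
    .positive   : All (0 <_) parts

open Partition public

∅ : Partition
∅ = mkPartition [] [] []

𝕐⁺ : Pred Partition 0ℓ
𝕐⁺ μ = μ ≢ ∅

private
  drop-decreasing : ∀ i {l} → Linked _≥_ l → Linked _≥_ (drop i l)
  drop-decreasing zero    l↓          = l↓
  drop-decreasing (suc i) []          = []
  drop-decreasing (suc i) {_ ∷ _} l↓  = drop-decreasing i (tail l↓)

  replicate-decreasing : ∀ n x → Linked _≥_ (replicate n x)
  replicate-decreasing zero          x = []
  replicate-decreasing (suc zero)    x = [-]
  replicate-decreasing (suc (suc n)) x = ≤-refl ∷ replicate-decreasing (suc n) x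

-- Truncated subtraction sends every nonpositive entry to 0.  As the
-- entries are weakly decreasing, these are all trailing, so that
-- discarding every 0 discards exactly the trailing nonpositive entries.
infix 9 _[_,_]
_[_,_] : Partition → ℕ → ℕ → Partition
mkPartition l l↓ _ [ i , j ] = mkPartition
  (filter (0 <?_) (map (_∸ j) (drop i l)))
  (Linked.filter⁺ (0 <?_) (λ y≤x z≤y → ≤-trans z≤y y≤x)
    (Linked.map⁺ (Linked.map (∸-monoˡ-≤ j) (drop-decreasing i l↓))))
  (All.all-filter (0 <?_) (map (_∸ j) (drop i l)))

-- [5,4^k]
5,4^_ : ℕ → Partition
5,4^ k = mkPartition (5 ∷ replicate k 4) (decr k) (z<s ∷ All.replicate⁺ k z<s)
  where
  decr : ∀ k → Linked _≥_ (5 ∷ replicate k 4)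
  decr zero    = [-]
  decr (suc k) = n≤1+n 4 ∷ replicate-decreasing (suc k) 4

------------------------------------------------------------------------
-- Impartial chess games

record Moveset : Set₁ where
  field
    Allows  : ℕ → ℕ → Set
    nonzero : ¬ Allows 0 0

open Moveset public

data QueenAllows : ℕ → ℕ → Set where
  vertical   : ∀ {k} → k ≥ 1 → QueenAllows k 0
  horizontal : ∀ {k} → k ≥ 1 → QueenAllows 0 k
  diagonal   : ∀ {k} → k ≥ 1 → QueenAllows k k

Queen : Moveset
Queen = record
  { Allows  = QueenAllows
  ; nonzero = λ { (vertical ()) ; (horizontal ()) ; (diagonal ()) }
  }

-- v is the least natural number not in S.
IsMex : Pred ℕ 0ℓ → ℕ → Set
IsMex S v = ¬ S v × (∀ w → ¬ S w → v ≤ w)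

module _ (M : Moveset) where

  Move : Partition → Partition → Set
  Move μ ν = ∃[ i ] ∃[ j ] Allows M i j × ν ≡ μ [ i , j ] × 𝕐⁺ ν

  Terminal : Partition → Set
  Terminal μ = ∀ ν → ¬ Move μ ν

  Image : ∀ μ → (∀ ν → Move μ ν → ℕ) → Pred ℕ 0ℓ
  Image μ f w = ∃[ ν ] ∃ λ (m : Move μ ν) → f ν m ≡ w

  -- SpragueGrundy μ t says that t is the Sprague-Grundy value of μ.  The
  -- recursion is an inductive definition, where strict positivity requires
  -- the values f of the options to be given before their mex is taken.
  -- At a terminal position the mex is that of the empty set, 0.
  data SpragueGrundy (μ : Partition) : ℕ → Set where
    mex : ∀ {t} (f : ∀ ν → Move μ ν → ℕ) →
          (∀ ν (m : Move μ ν) → SpragueGrundy ν (f ν m)) →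
          IsMex (Image μ f) t →
          SpragueGrundy μ t

  data MisèreGrundy (μ : Partition) : ℕ → Set where
    terminal : Terminal μ → MisèreGrundy μ 1
    mex      : ∀ {ℓ} → ¬ Terminal μ →
               (f : ∀ ν → Move μ ν → ℕ) →
               (∀ ν (m : Move μ ν) → MisèreGrundy ν (f ν m)) →
               IsMex (Image μ f) ℓ →
               MisèreGrundy μ ℓ

  _is⟨_,_⟩-position : Partition → ℕ → ℕ → Set
  μ is⟨ t , ℓ ⟩-position = SpragueGrundy μ t × MisèreGrundy μ ℓ

  MoveTo⟨_,_⟩ : ℕ → ℕ → Pred Partition 0ℓ
  MoveTo⟨ t , ℓ ⟩ x = ∃[ y ] Move x y × y is⟨ t , ℓ ⟩-position

  -- The positions of the game (M , λ) starting at λ.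
  PositionOf : Partition → Pred Partition 0ℓ
  PositionOf = Star Move

  Returnable : Pred Partition 0ℓ
  Returnable λ′ = ∀ x → PositionOf λ′ x → ∀ y → Move x y → ¬ Terminal y →
    (x is⟨ 0 , 1 ⟩-position → MoveTo⟨ 0 , 1 ⟩ y) ×
    (x is⟨ 1 , 0 ⟩-position → MoveTo⟨ 1 , 0 ⟩ y)

  Forced : Pred Partition 0ℓ
  Forced λ′ = ∀ x → PositionOf λ′ x → ∀ y → Move x y →
    (x is⟨ 0 , 1 ⟩-position → y is⟨ 1 , 0 ⟩-position) ×
    (x is⟨ 1 , 0 ⟩-position → y is⟨ 0 , 1 ⟩-position)

  Tame : Pred Partition 0ℓ
  Tame λ′ = ∀ x → PositionOf λ′ x →
    x is⟨ 0 , 1 ⟩-position ⊎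
    x is⟨ 1 , 0 ⟩-position ⊎
    (∃[ k ] x is⟨ k , k ⟩-position)

  Miserable : Pred Partition 0ℓ
  Miserable λ′ = ∀ x → PositionOf λ′ x →
    (x is⟨ 0 , 1 ⟩-position ⊎ x is⟨ 1 , 0 ⟩-position) ⊎
    ¬ (MoveTo⟨ 0 , 1 ⟩ x ⊎ MoveTo⟨ 1 , 0 ⟩ x) ⊎
    (MoveTo⟨ 0 , 1 ⟩ x × MoveTo⟨ 1 , 0 ⟩ x)

------------------------------------------------------------------------
-- Families of games

record Family : Set₁ where
  constructor _on_⟨_⟩
  field
    moveset  : Moveset
    starts   : Pred Partition 0ℓ
    nonempty : starts ⊆ 𝕐⁺

open Family public

_Has_ : Family → (Moveset → Pred Partition 0ℓ) → Set
F Has Property = ∀ λ′ → starts F λ′ → Property (moveset F) λ′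

_HasNot_ : Family → (Moveset → Pred Partition 0ℓ) → Set
F HasNot Property = ∃[ λ′ ] starts F λ′ × ¬ Property (moveset F) λ′

S₂ : Pred Partition 0ℓ
S₂ μ = 𝕐⁺ μ × ∃[ k ] k ≥ 7 × ∃[ i ] ∃[ j ] μ ≡ (5,4^ k) [ i , j ]

QueenOnS₂ : Family
QueenOnS₂ = Queen on S₂ ⟨ (λ (μ∈𝕐⁺ , _) → μ∈𝕐⁺) ⟩

{-# OPTIONS --safe #-}
-- Rectangular positions play as Wythoff's game on a strip of width at most 4;
-- the others are the hooks [c+2,(c+1)^m] with m ≥ 7.  If the options have
-- normal and misère values that agree except for exchanges of 0 and 1, and both
-- 0 and 1 occur in each play, then the two mex values agree and are at least 2.
-- This covers all but eight small rectangles, so it suffices to track values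
-- capped at 2: by removing rows, a long [(c+1)^m] or [c+2,(c+1)^m] reaches both
-- a (0,1)- and a (1,0)-position if c < 3, and the (0,0)-position [4^6] and the
-- (1,1)-position [4^7] if c = 3.

module Submission where

open import Defs
open import Data.Empty using (⊥-elim)
open import Data.List.Base using (List; []; _∷_; _++_; map; drop; filter; replicate; length; applyUpTo)
import Data.List.Extrema.Nat as Extrema
open import Data.List.Membership.Propositional using (_∈_; _∉_; find)
open import Data.List.Membership.Propositional.Properties
  using (∈-map⁻; ∈-map⁺; ∈-++⁺ˡ; ∈-++⁺ʳ; ∈-++⁻; ∈-applyUpTo⁺; ∈-applyUpTo⁻)
open import Data.List.Properties
  using (length-map; filter-all; filter-none; map-replicate; map-∘; map-cong)
open import Data.List.Relation.Unary.All as All using (All; []; _∷_)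
import Data.List.Relation.Unary.All.Properties as All
open import Data.List.Relation.Unary.Any using (Any; here; there; any?)
open import Data.List.Relation.Unary.Linked using (Linked; []; [-]; _∷_)
open import Data.Nat.Base
open import Data.Nat.Induction using (<-wellFounded)
open import Data.Nat.Properties
open import Data.List.Membership.DecPropositional _≟_ using (_∈?_)
open import Data.Product.Base using (_×_; _,_; ∃; ∃₂; ∃-syntax; proj₁; proj₂)
open import Data.Sum.Base using (_⊎_; inj₁; inj₂)
open import Function.Base using (_∘_)
open import Function.Bundles using (_⇔_; mk⇔; Equivalence)
open import Induction.WellFounded using (Acc; acc)
open import Level using (0ℓ)
open import Relation.Binary.Construct.Closure.ReflexiveTransitive using (ε; _◅_)
open import Relation.Binary.PropositionalEquality hiding ([_])
open import Relation.Nullary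
open import Relation.Nullary.Decidable using (True; toWitness; _×-dec_; _⊎-dec_; _→-dec_; ¬?; from-yes)
open import Relation.Unary using (Pred; Decidable)

open Equivalence using (to; from)

-- Minimal excluded values

mex-unique : ∀ {S T : Pred ℕ 0ℓ} {m n} → (∀ w → S w ⇔ T w) → IsMex S m → IsMex T n → m ≡ n
mex-unique S⇔T (m∉S , m-least) (n∉T , n-least) = ≤-antisym
  (m-least _ (n∉T ∘ to (S⇔T _)))
  (n-least _ (m∉S ∘ from (S⇔T _)))

mex-resp-⇔ : ∀ {S T : Pred ℕ 0ℓ} {n} → (∀ w → S w ⇔ T w) → IsMex S n → IsMex T n
mex-resp-⇔ S⇔T (n∉S , n-least) = n∉S ∘ from (S⇔T _) , λ w w∉T → n-least w (w∉T ∘ to (S⇔T w))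

least : ∀ {P : Pred ℕ 0ℓ} → Decidable P → ∀ n → P n → ∃[ m ] P m × (∀ w → P w → m ≤ w)
least P? n Pn with P? 0
... | yes P0 = 0 , P0 , λ _ _ → z≤n
least P? zero    P0 | no ¬P0 = contradiction P0 ¬P0
least P? (suc n) Pn | no ¬P0 with least (P? ∘ suc) n Pn
... | m , Pm , m-least = suc m , Pm , λ where
  zero    P0 → contradiction P0 ¬P0
  (suc w) Pw → s≤s (m-least w Pw)

mex-exists : ∀ ns → ∃[ n ] IsMex (_∈ ns) n
mex-exists ns = least (λ w → ¬? (w ∈? ns)) (suc (Extrema.max 0 ns))
  (λ bound∈ns → 1+n≰n (All.lookup (Extrema.xs≤max 0 ns) bound∈ns))

-- The mex of ns is n for n < 2, and at least 2 otherwise.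
CappedMex : ℕ → List ℕ → Set
CappedMex 0             ns = 0 ∉ ns
CappedMex 1             ns = 0 ∈ ns × 1 ∉ ns
CappedMex (suc (suc _)) ns = 0 ∈ ns × 1 ∈ ns

cappedMex? : ∀ n ns → Dec (CappedMex n ns)
cappedMex? 0             ns = ¬? (0 ∈? ns)
cappedMex? 1             ns = 0 ∈? ns ×-dec ¬? (1 ∈? ns)
cappedMex? (suc (suc _)) ns = 0 ∈? ns ×-dec 1 ∈? ns

cap : ℕ → ℕ
cap = 2 ⊓_

cap-injective : ∀ {w n} → w < 2 → w ≡ cap n → w ≡ n
cap-injective {n = 0}           _   eq   = eq
cap-injective {n = 1}           _   eq   = eq
cap-injective {n = suc (suc _)} w<2 refl = contradiction w<2 (<-irrefl refl)

∈-map-cap⁻ : ∀ {w ns} → w < 2 → w ∈ map cap ns → w ∈ ns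
∈-map-cap⁻ w<2 w∈ with ∈-map⁻ cap w∈
... | n , n∈ns , eq = subst (_∈ _) (sym (cap-injective w<2 eq)) n∈ns

-- Whether a mex is 0 or 1 depends only on the presence of 0 and 1, which capping preserves.
cappedMex⇒mex : ∀ {n ns} → n < 2 → CappedMex n (map cap ns) → IsMex (_∈ ns) n
cappedMex⇒mex {0} _ 0∉ = 0∉ ∘ ∈-map⁺ cap , λ _ _ → z≤n
cappedMex⇒mex {1} _ (0∈ , 1∉) = 1∉ ∘ ∈-map⁺ cap , λ where
  zero    0∉ → contradiction (∈-map-cap⁻ z<s 0∈) 0∉
  (suc w) _  → s≤s z≤n
cappedMex⇒mex {suc (suc _)} (s≤s (s≤s ()))

-- Uniqueness of Grundy values

module _ {M : Moveset} where

  -- Two derivations may carry formally different functions on the options; by induction these agree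
  -- pointwise, so their images and hence the mex values coincide.
  sg-unique : ∀ {μ s t} → SpragueGrundy M μ s → SpragueGrundy M μ t → s ≡ t
  sg-unique (mex f f-sg s-mex) (mex g g-sg t-mex) = mex-unique
    (λ w → mk⇔ (λ (ν , m , eq) → ν , m , trans (sym (f≡g ν m)) eq)
                (λ (ν , m , eq) → ν , m , trans (f≡g ν m) eq))
    s-mex t-mex
    where
    f≡g : ∀ ν m → f ν m ≡ g ν m
    f≡g ν m = sg-unique (f-sg ν m) (g-sg ν m)

  mg-unique : ∀ {μ s t} → MisèreGrundy M μ s → MisèreGrundy M μ t → s ≡ t
  mg-unique (terminal _) (terminal _) = refl
  mg-unique (terminal end) (mex ¬end _ _ _) = contradiction end ¬end
  mg-unique (mex ¬end _ _ _) (terminal end) = contradiction end ¬end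
  mg-unique (mex _ f f-mg s-mex) (mex _ g g-mg t-mex) = mex-unique
    (λ w → mk⇔ (λ (ν , m , eq) → ν , m , trans (sym (f≡g ν m)) eq)
                (λ (ν , m , eq) → ν , m , trans (f≡g ν m) eq))
    s-mex t-mex
    where
    f≡g : ∀ ν m → f ν m ≡ g ν m
    f≡g ν m = mg-unique (f-mg ν m) (g-mg ν m)

-- Positions

parts-injective : ∀ {μ ν} → parts μ ≡ parts ν → μ ≡ ν
parts-injective {mkPartition _ _ _} {mkPartition _ _ _} refl = refl

-- rect c m stands for [(c+1)^(m+1)] and hook c m for [c+2,(c+1)^(m+7)].
-- The shifts make every rectangle nonempty and every hook long enough.
data Pos : Set where
  rect hook : (c m : ℕ) → Pos

drop-replicate : ∀ i n (x : ℕ) → drop i (replicate n x) ≡ replicate (n ∸ i) x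
drop-replicate zero    n       x = refl
drop-replicate (suc i) zero    x = refl
drop-replicate (suc i) (suc n) x = drop-replicate i n x

replicate-decreasing : ∀ n x → Linked _≥_ (replicate n x)
replicate-decreasing zero          x = []
replicate-decreasing (suc zero)    x = [-]
replicate-decreasing (suc (suc n)) x = ≤-refl ∷ replicate-decreasing (suc n) x

⟦_⟧ : Pos → Partition
⟦ rect c m ⟧ = mkPartition (replicate (suc m) (suc c))
  (replicate-decreasing (suc m) (suc c)) (All.replicate⁺ (suc m) z<s)
⟦ hook c m ⟧ = mkPartition (suc (suc c) ∷ replicate (7 + m) (suc c))
  (n≤1+n (suc c) ∷ replicate-decreasing (7 + m) (suc c)) (z<s ∷ All.replicate⁺ (7 + m) z<s)

⟦⟧-nonempty : ∀ p → 𝕐⁺ ⟦ p ⟧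
⟦⟧-nonempty (rect c m) ()
⟦⟧-nonempty (hook c m) ()

-- Cutting rows and columns off rectangles and hooks

shift : ℕ → List ℕ → List ℕ
shift j l = filter (0 <?_) (map (_∸ j) l)

shift-replicate : ∀ {j c} n → j ≤ c → shift j (replicate n (suc c)) ≡ replicate n (suc (c ∸ j))
shift-replicate {j} {c} n j≤c = begin
  shift j (replicate n (suc c))                ≡⟨ cong (filter (0 <?_)) (map-replicate (_∸ j) n (suc c)) ⟩
  filter (0 <?_) (replicate n (suc c ∸ j))     ≡⟨ cong (filter (0 <?_) ∘ replicate n) (+-∸-assoc 1 j≤c) ⟩
  filter (0 <?_) (replicate n (suc (c ∸ j)))   ≡⟨ filter-all (0 <?_) (All.replicate⁺ n z<s) ⟩
  replicate n (suc (c ∸ j))                    ∎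
  where open ≡-Reasoning

shift-vanish : ∀ {j l} → All (_≤ j) l → shift j l ≡ []
shift-vanish {j} l≤j = filter-none (0 <?_)
  (All.map⁺ (All.map (λ x≤j → subst (λ y → ¬ 0 < y) (sym (m≤n⇒m∸n≡0 x≤j)) λ ()) l≤j))

rect-shift : ∀ {c m i j} → i ≤ m → j ≤ c → ⟦ rect c m ⟧ [ i , j ] ≡ ⟦ rect (c ∸ j) (m ∸ i) ⟧
rect-shift {c} {m} {i} {j} i≤m j≤c = parts-injective (begin
  shift j (drop i (replicate (suc m) (suc c)))   ≡⟨ cong (shift j) (drop-replicate i (suc m) (suc c)) ⟩
  shift j (replicate (suc m ∸ i) (suc c))        ≡⟨ shift-replicate (suc m ∸ i) j≤c ⟩
  replicate (suc m ∸ i) (suc (c ∸ j))            ≡⟨ cong (λ n → replicate n (suc (c ∸ j))) (+-∸-assoc 1 i≤m) ⟩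
  replicate (suc (m ∸ i)) (suc (c ∸ j))          ∎)
  where open ≡-Reasoning

rect-nonempty : ∀ {c m i j} → 𝕐⁺ (⟦ rect c m ⟧ [ i , j ]) → i ≤ m × j ≤ c
rect-nonempty {c} {m} {i} {j} ne with i ≤? m | j ≤? c
... | yes i≤m | yes j≤c = i≤m , j≤c
... | no i≰m  | _       = ⊥-elim (ne (parts-injective (trans
  (cong (shift j) (drop-replicate i (suc m) (suc c)))
  (cong (λ n → shift j (replicate n (suc c))) (m≤n⇒m∸n≡0 (≰⇒> i≰m))))))
... | _       | no j≰c  = ⊥-elim (ne (parts-injective
  (shift-vanish {j} (All.drop⁺ i (All.replicate⁺ (suc m) (≰⇒> j≰c))))))

hook-shift : ∀ {c m j} → j ≤ c → ⟦ hook c m ⟧ [ 0 , j ] ≡ ⟦ hook (c ∸ j) m ⟧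
hook-shift {c} {m} {j} j≤c = parts-injective (begin
  shift j (suc (suc c) ∷ replicate (7 + m) (suc c))
    ≡⟨ cong (λ x → filter (0 <?_) (x ∷ map (_∸ j) (replicate (7 + m) (suc c)))) (+-∸-assoc 2 j≤c) ⟩
  suc (suc (c ∸ j)) ∷ shift j (replicate (7 + m) (suc c))
    ≡⟨ cong (suc (suc (c ∸ j)) ∷_) (shift-replicate (7 + m) j≤c) ⟩
  suc (suc (c ∸ j)) ∷ replicate (7 + m) (suc (c ∸ j)) ∎)
  where open ≡-Reasoning

-- Every part but the first equals the number of removed columns and vanishes; the first keeps one
-- cell.
hook-corner : ∀ c {m} → ⟦ hook c m ⟧ [ 0 , suc c ] ≡ ⟦ rect 0 0 ⟧
hook-corner c {m} = parts-injective (begin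
  shift (suc c) (suc (suc c) ∷ replicate (7 + m) (suc c))
    ≡⟨ cong (λ x → filter (0 <?_) (x ∷ map (_∸ suc c) (replicate (7 + m) (suc c)))) (m+n∸n≡m 1 c) ⟩
  1 ∷ shift (suc c) (replicate (7 + m) (suc c))
    ≡⟨ cong (1 ∷_) (shift-vanish {suc c} (All.replicate⁺ (7 + m) ≤-refl)) ⟩
  1 ∷ [] ∎)
  where open ≡-Reasoning

hook-nonempty : ∀ {c m j} → 𝕐⁺ (⟦ hook c m ⟧ [ 0 , j ]) → j ≤ suc c
hook-nonempty {c} {m} {j} ne with j ≤? suc c
... | yes j≤ = j≤
... | no j≰  = ⊥-elim (ne (parts-injective (shift-vanish {j}
  (≰⇒> j≰ ∷ All.replicate⁺ (7 + m) (<⇒≤ (≰⇒> j≰))))))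

-- Options

-- Indexed by the rows that remain, not by those removed, so that the shortest rectangles come first
-- and are explicit even for a height `n + m` with `n` a numeral and `m` a variable.
rows : ℕ → ℕ → List Pos
rows c m = applyUpTo (rect c) m

diagonals : ℕ → ℕ → List Pos
diagonals c m = applyUpTo (λ k → rect (c ∸ suc k) (m ∸ suc k)) (c ⊓ m)

-- The options that remove at least one row. `hook c m` and `rect c (7 + m)` differ only in the
-- first row, so they share them.
inner : ℕ → ℕ → List Pos
inner c m = rows c m ++ diagonals c m

options : Pos → List Pos
options (rect c m) = inner c m ++ applyUpTo (λ k → rect k m) c
options (hook c m) = inner c (7 + m) ++ rect 0 0 ∷ applyUpTo (λ k → hook k m) c

inner-complete : ∀ {c m i j} → QueenAllows (suc i) j → 𝕐⁺ (⟦ rect c m ⟧ [ suc i , j ]) →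
  ∃[ q ] q ∈ inner c m × ⟦ rect c m ⟧ [ suc i , j ] ≡ ⟦ q ⟧
inner-complete {c} {m} {i} (vertical _) ne with rect-nonempty {c} {m} {suc i} {0} ne
... | i<m , _ = _ , ∈-++⁺ˡ (∈-applyUpTo⁺ (rect c) (∸-monoʳ-< z<s i<m)) , rect-shift i<m z≤n
inner-complete {c} {m} {i} (diagonal _) ne with rect-nonempty {c} {m} {suc i} {suc i} ne
... | i<m , i<c = _ ,
  ∈-++⁺ʳ (rows c m) (∈-applyUpTo⁺ (λ k → rect (c ∸ suc k) (m ∸ suc k)) (⊓-glb i<c i<m)) ,
  rect-shift i<m i<c

inner-sound : ∀ {c m q} → q ∈ inner c m →
  ∃₂ λ i j → QueenAllows (suc i) j × ⟦ rect c m ⟧ [ suc i , j ] ≡ ⟦ q ⟧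
inner-sound {c} {m} q∈ with ∈-++⁻ (rows c m) q∈
... | inj₁ q∈rows with ∈-applyUpTo⁻ (rect c) q∈rows
-- `rect c k` keeps k+1 of the m+1 rows, so `m ∸ k` rows go, a number that has to appear here as a
-- successor.
...   | k , k<m , refl = m ∸ suc k , 0 , vertical z<s ,
  trans (rect-shift (subst (_≤ m) m∸k≡ (m∸n≤m m k)) z≤n)
        (cong (λ n → ⟦ rect c n ⟧) (trans (cong (m ∸_) (sym m∸k≡)) (m∸[m∸n]≡n (<⇒≤ k<m))))
  where
  m∸k≡ : m ∸ k ≡ suc (m ∸ suc k)
  m∸k≡ = +-∸-assoc 1 k<m
inner-sound {c} {m} q∈ | inj₂ q∈diagonals
  with ∈-applyUpTo⁻ (λ k → rect (c ∸ suc k) (m ∸ suc k)) q∈diagonals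
... | k , k<c⊓m , refl = k , suc k , diagonal z<s ,
  rect-shift (m≤n⊓o⇒m≤o c m k<c⊓m) (m≤n⊓o⇒m≤n c m k<c⊓m)

options-complete : ∀ p {ν} → Move Queen ⟦ p ⟧ ν → ∃[ q ] q ∈ options p × ν ≡ ⟦ q ⟧
options-complete (rect c m) (suc i , j , allowed , refl , ne) with inner-complete {c} {m} allowed ne
... | q , q∈ , eq = q , ∈-++⁺ˡ q∈ , eq
options-complete (rect c m) (0 , j , horizontal j≥1 , refl , ne) with rect-nonempty {c} {m} {0} {j} ne
... | _ , j≤c = _ ,
  ∈-++⁺ʳ (inner c m) (∈-applyUpTo⁺ (λ k → rect k m) (∸-monoʳ-< j≥1 j≤c)) , rect-shift z≤n j≤c
options-complete (hook c m) (suc i , j , allowed , refl , ne) with inner-complete {c} {7 + m} allowed ne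
... | q , q∈ , eq = q , ∈-++⁺ˡ q∈ , eq
options-complete (hook c m) (0 , j , horizontal j≥1 , refl , ne) with m≤n⇒m<n∨m≡n (hook-nonempty {c} {m} {j} ne)
... | inj₁ (s≤s j≤c) = _ ,
  ∈-++⁺ʳ (inner c (7 + m)) (there (∈-applyUpTo⁺ (λ k → hook k m) (∸-monoʳ-< j≥1 j≤c))) ,
  hook-shift j≤c
... | inj₂ refl = _ , ∈-++⁺ʳ (inner c (7 + m)) (here refl) , hook-corner c

options-sound : ∀ p {q} → q ∈ options p → Move Queen ⟦ p ⟧ ⟦ q ⟧
options-sound (rect c m) {q} q∈ with ∈-++⁻ (inner c m) q∈
... | inj₁ q∈inner with inner-sound {c} {m} q∈inner
...   | i , j , allowed , eq = suc i , j , allowed , sym eq , ⟦⟧-nonempty q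
options-sound (rect c m) {q} q∈ | inj₂ q∈columns with ∈-applyUpTo⁻ (λ k → rect k m) q∈columns
... | k , k<c , refl = 0 , c ∸ k , horizontal (m<n⇒0<n∸m k<c) ,
  sym (trans (rect-shift {m = m} z≤n (m∸n≤m c k))
             (cong (λ n → ⟦ rect n m ⟧) (m∸[m∸n]≡n (<⇒≤ k<c)))) ,
  ⟦⟧-nonempty q
options-sound (hook c m) {q} q∈ with ∈-++⁻ (inner c (7 + m)) q∈
... | inj₁ q∈inner with inner-sound {c} {7 + m} q∈inner
...   | i , j , allowed , eq = suc i , j , allowed , sym eq , ⟦⟧-nonempty q
options-sound (hook c m) q∈ | inj₂ (here refl) =
  0 , suc c , horizontal z<s , sym (hook-corner c) , ⟦⟧-nonempty (rect 0 0)
options-sound (hook c m) {q} q∈ | inj₂ (there q∈columns) with ∈-applyUpTo⁻ (λ k → hook k m) q∈columns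
... | k , k<c , refl = 0 , c ∸ k , horizontal (m<n⇒0<n∸m k<c) ,
  sym (trans (hook-shift {m = m} (m∸n≤m c k))
             (cong (λ n → ⟦ hook n m ⟧) (m∸[m∸n]≡n (<⇒≤ k<c)))) ,
  ⟦⟧-nonempty q

width size : Pos → ℕ
width (rect c m) = c
width (hook c m) = c
size (rect c m) = c + m
size (hook c m) = c + (8 + m)

inner-smaller : ∀ c m → All (λ q → width q ≤ c × size q < c + m) (inner c m)
inner-smaller c m = All.++⁺
  (All.applyUpTo⁺₁ (rect c) m (λ k<m → ≤-refl , +-monoʳ-< c k<m))
  (All.applyUpTo⁺₁ (λ k → rect (c ∸ suc k) (m ∸ suc k)) (c ⊓ m) (λ {k} k<c⊓m →
    m∸n≤m c (suc k) ,
    +-mono-<-≤ (∸-monoʳ-< z<s (m≤n⊓o⇒m≤n c m k<c⊓m)) (m∸n≤m m (suc k))))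

-- The fall in `size` drives the recursion in `value`; the bound on `width` keeps every option in
-- the range of `regular`.
options-smaller : ∀ p → All (λ q → width q ≤ width p × size q < size p) (options p)
options-smaller (rect c m) = All.++⁺ (inner-smaller c m)
  (All.applyUpTo⁺₁ (λ k → rect k m) c (λ k<c → <⇒≤ k<c , +-monoˡ-< m k<c))
options-smaller (hook c m) = All.++⁺
  (All.map (λ (w≤ , s<) → w≤ , <-trans s< (+-monoʳ-< c ≤-refl)) (inner-smaller c (7 + m)))
  ((z≤n , ≤-trans z<s (m≤n+m (8 + m) c)) ∷
   All.applyUpTo⁺₁ (λ k → hook k m) c (λ k<c → <⇒≤ k<c , +-monoˡ-< (8 + m) k<c))

no-options⇒terminal : ∀ p → length (options p) ≡ 0 → Terminal Queen ⟦ p ⟧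
no-options⇒terminal p none ν move with options p | options-complete p move
no-options⇒terminal p ()   ν move | _ ∷ _ | _
... | [] | _ , () , _

option⇒¬terminal : ∀ p → 0 < length (options p) → ¬ Terminal Queen ⟦ p ⟧
option⇒¬terminal p some end with options p | options-sound p
... | q ∷ _ | sound = end _ (sound (here refl))

-- Values

-- The types that occur in a tame game, with all (k,k) for k ≥ 2 merged: their exact size cannot
-- decide whether a mex is 0, 1 or larger.
data Kind : Set where
  ⟨0,1⟩ ⟨1,0⟩ ⟨0,0⟩ ⟨1,1⟩ ⟨k,k⟩ : Kind

-- The number in a value is relevant only for the kind ⟨k,k⟩, where it is k ∸ 2.
Value : Set
Value = Kind × ℕ

normal misère : Value → ℕ
normal (⟨0,1⟩ , _) = 0
normal (⟨1,0⟩ , _) = 1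
normal (⟨0,0⟩ , _) = 0
normal (⟨1,1⟩ , _) = 1
normal (⟨k,k⟩ , k) = 2 + k
misère (⟨0,1⟩ , _) = 1
misère (⟨1,0⟩ , _) = 0
misère (⟨0,0⟩ , _) = 0
misère (⟨1,1⟩ , _) = 1
misère (⟨k,k⟩ , k) = 2 + k

-- The second component 0 makes `⟨k,k⟩` read as 2, the cap.
cappedNormal cappedMisère : Kind → ℕ
cappedNormal κ = normal (κ , 0)
cappedMisère κ = misère (κ , 0)

cap-normal : ∀ v → cap (normal v) ≡ cappedNormal (proj₁ v)
cap-normal (⟨0,1⟩ , _) = refl
cap-normal (⟨1,0⟩ , _) = refl
cap-normal (⟨0,0⟩ , _) = refl
cap-normal (⟨1,1⟩ , _) = refl
cap-normal (⟨k,k⟩ , _) = refl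

cap-misère : ∀ v → cap (misère v) ≡ cappedMisère (proj₁ v)
cap-misère (⟨0,1⟩ , _) = refl
cap-misère (⟨1,0⟩ , _) = refl
cap-misère (⟨0,0⟩ , _) = refl
cap-misère (⟨1,1⟩ , _) = refl
cap-misère (⟨k,k⟩ , _) = refl

normal≡misère∨small : ∀ v → normal v ≡ misère v ⊎ normal v < 2 × misère v < 2
normal≡misère∨small (⟨0,1⟩ , _) = inj₂ (s≤s z≤n , s≤s (s≤s z≤n))
normal≡misère∨small (⟨1,0⟩ , _) = inj₂ (s≤s (s≤s z≤n) , s≤s z≤n)
normal≡misère∨small (⟨0,0⟩ , _) = inj₁ refl
normal≡misère∨small (⟨1,1⟩ , _) = inj₁ refl
normal≡misère∨small (⟨k,k⟩ , _) = inj₁ refl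

-- Nonemptiness excludes the terminal position, whose misère value is set by convention and is not a
-- mex.
Consistent : Kind → List Kind → Set
Consistent κ κs = CappedMex (cappedNormal κ) (map cappedNormal κs)
             × CappedMex (cappedMisère κ) (map cappedMisère κs)
             × 0 < length κs

consistent? : ∀ κ κs → Dec (Consistent κ κs)
consistent? κ κs = cappedMex? _ _ ×-dec cappedMex? _ _ ×-dec 0 <? length κs

cap-values : ∀ {f : Value → ℕ} {g : Kind → ℕ} → (∀ v → cap (f v) ≡ g (proj₁ v)) →
  ∀ vs → map g (map proj₁ vs) ≡ map cap (map f vs)
cap-values {f} {g} cap-f vs = begin
  map g (map proj₁ vs)   ≡⟨ map-∘ vs ⟨
  map (g ∘ proj₁) vs     ≡⟨ map-cong cap-f vs ⟨
  map (cap ∘ f) vs       ≡⟨ map-∘ vs ⟩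
  map cap (map f vs)     ∎
  where open ≡-Reasoning

-- A value on which `f` and `g` disagree is sent by `f` to 0 or 1, and both are in the image of `g`
-- anyway.
∈-map-small : ∀ {f g : Value → ℕ} → (∀ v → f v ≡ g v ⊎ f v < 2 × g v < 2) →
  ∀ {vs} → 0 ∈ map g vs → 1 ∈ map g vs → ∀ {w} → w ∈ map f vs → w ∈ map g vs
∈-map-small {f} {g} f≡g {vs} 0∈ 1∈ w∈ with ∈-map⁻ f w∈
... | v , v∈vs , refl with f≡g v
...   | inj₁ eq = subst (_∈ map g vs) (sym eq) (∈-map⁺ g v∈vs)
...   | inj₂ (fv<2 , _) = small fv<2
  where
  small : ∀ {n} → n < 2 → n ∈ map g vs
  small {0}           _ = 0∈
  small {1}           _ = 1∈
  small {suc (suc _)} (s≤s (s≤s ()))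

-- For `⟨k,k⟩`, 0 and 1 occur among the options in both plays, so the normal and the misère values
-- form the same set, with one mex of at least 2. For the other kinds the capped data settle both
-- mex values.
mex-values : ∀ κ vs → Consistent κ (map proj₁ vs) →
  ∃[ k ] IsMex (_∈ map normal vs) (normal (κ , k)) × IsMex (_∈ map misère vs) (misère (κ , k))
mex-values κ vs (n-mex , m-mex , _)
  rewrite cap-values cap-normal vs | cap-values cap-misère vs with κ
... | ⟨0,1⟩ = 0 , cappedMex⇒mex (s≤s z≤n) n-mex , cappedMex⇒mex (s≤s (s≤s z≤n)) m-mex
... | ⟨1,0⟩ = 0 , cappedMex⇒mex (s≤s (s≤s z≤n)) n-mex , cappedMex⇒mex (s≤s z≤n) m-mex
... | ⟨0,0⟩ = 0 , cappedMex⇒mex (s≤s z≤n) n-mex , cappedMex⇒mex (s≤s z≤n) m-mex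
... | ⟨1,1⟩ = 0 , cappedMex⇒mex (s≤s (s≤s z≤n)) n-mex , cappedMex⇒mex (s≤s (s≤s z≤n)) m-mex
... | ⟨k,k⟩ with mex-exists (map normal vs) | n-mex | m-mex
...   | n , isMex | 0∈n , 1∈n | 0∈m , 1∈m with n | isMex
...     | 0           | 0∉ , _ = contradiction (∈-map-cap⁻ z<s 0∈n) 0∉
...     | 1           | 1∉ , _ = contradiction (∈-map-cap⁻ ≤-refl 1∈n) 1∉
...     | suc (suc k) | isMex′ = k , isMex′ , mex-resp-⇔ n⇔m isMex′
  where
  swap-small : ∀ v → misère v ≡ normal v ⊎ misère v < 2 × normal v < 2
  swap-small v with normal≡misère∨small v
  ... | inj₁ eq      = inj₁ (sym eq)
  ... | inj₂ (p , q) = inj₂ (q , p)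
  n⇔m : ∀ w → w ∈ map normal vs ⇔ w ∈ map misère vs
  n⇔m w = mk⇔
    (∈-map-small normal≡misère∨small (∈-map-cap⁻ z<s 0∈m) (∈-map-cap⁻ ≤-refl 1∈m))
    (∈-map-small swap-small (∈-map-cap⁻ z<s 0∈n) (∈-map-cap⁻ ≤-refl 1∈n))

-- The table of kinds and its verification

-- The exceptions are [1], [1^2], [2], [2^3], [3^2], [3^3], [4^6] and [4^7]: the positions of
-- Wythoff's game with piles `c` ≤ 3 and `m` whose value is 0 or 1. The table is a prediction for
-- width at most 3, which `regular` verifies.
kind : Pos → Kind
kind (rect 0 0) = ⟨0,1⟩
kind (rect 0 1) = ⟨1,0⟩
kind (rect 1 0) = ⟨1,0⟩
kind (rect 1 2) = ⟨0,1⟩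
kind (rect 2 1) = ⟨0,1⟩
kind (rect 2 2) = ⟨1,0⟩
kind (rect 3 5) = ⟨0,0⟩
kind (rect 3 6) = ⟨1,1⟩
kind _          = ⟨k,k⟩

-- A decidable stand-in for being a (t,ℓ)-position, faithful for t and ℓ below 2 and width at most
-- 3.
Reads : ℕ → ℕ → Pos → Set
Reads t ℓ p = cappedNormal (kind p) ≡ t × cappedMisère (kind p) ≡ ℓ

reads? : ∀ t ℓ p → Dec (Reads t ℓ p)
reads? t ℓ p = cappedNormal (kind p) ≟ t ×-dec cappedMisère (kind p) ≟ ℓ

Returns : ℕ → ℕ → Pos → Set
Returns t ℓ p = All (λ q → length (options q) ≡ 0 ⊎ Any (Reads t ℓ) (options q)) (options p)

returns? : ∀ t ℓ p → Dec (Returns t ℓ p)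
returns? t ℓ p = All.all? (λ q → length (options q) ≟ 0 ⊎-dec any? (reads? t ℓ) (options q)) (options p)

-- Both premises fail at every kind other than `⟨0,1⟩` and `⟨1,0⟩`, so the content lies in the six
-- small rectangles of these kinds.
SwappedReturns : Pos → Set
SwappedReturns p = (Reads 0 1 p → Returns 0 1 p) × (Reads 1 0 p → Returns 1 0 p)

swappedReturns? : ∀ p → Dec (SwappedReturns p)
swappedReturns? p = (reads? 0 1 p →-dec returns? 0 1 p) ×-dec (reads? 1 0 p →-dec returns? 1 0 p)

-- The terminal position [1] alone is exempt from consistency.
Regular : Pos → Set
Regular p = (p ≡ rect 0 0 ⊎ Consistent (kind p) (map kind (options p))) × SwappedReturns p

-- For a large m the two options that decide the check stand at the front of
-- the list, so that it evaluates although m is a variable.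
checked : ∀ p → {True (consistent? (kind p) (map kind (options p)) ×-dec swappedReturns? p)} → Regular p
checked p {ok} with toWitness ok
... | consistent , returns = inj₂ consistent , returns

-- The case split stops once `rows` contains options that together supply 0 and 1 in both plays.
-- They sit at indices 0 and 1 for width 0, 0 and 2 for width 1, 1 and 2 for width 2, and 5 and 6
-- for width 3. The seven rows below the first row of a hook cover all of these.
regular : ∀ p → width p ≤ 3 → Regular p
regular (rect 0 0) _ = inj₁ refl , from-yes (swappedReturns? (rect 0 0))
regular (rect 0 1) _ = checked (rect 0 1)
regular (rect 0 (suc (suc m))) _ = checked (rect 0 (2 + m))
regular (rect 1 0) _ = checked (rect 1 0)
regular (rect 1 1) _ = checked (rect 1 1)
regular (rect 1 2) _ = checked (rect 1 2)
regular (rect 1 (suc (suc (suc m)))) _ = checked (rect 1 (3 + m))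
regular (rect 2 0) _ = checked (rect 2 0)
regular (rect 2 1) _ = checked (rect 2 1)
regular (rect 2 2) _ = checked (rect 2 2)
regular (rect 2 (suc (suc (suc m)))) _ = checked (rect 2 (3 + m))
regular (rect 3 0) _ = checked (rect 3 0)
regular (rect 3 1) _ = checked (rect 3 1)
regular (rect 3 2) _ = checked (rect 3 2)
regular (rect 3 3) _ = checked (rect 3 3)
regular (rect 3 4) _ = checked (rect 3 4)
regular (rect 3 5) _ = checked (rect 3 5)
regular (rect 3 6) _ = checked (rect 3 6)
regular (rect 3 (suc (suc (suc (suc (suc (suc (suc m)))))))) _ =
  checked (rect 3 (7 + m))
regular (hook 0 m) _ = checked (hook 0 m)
regular (hook 1 m) _ = checked (hook 1 m)
regular (hook 2 m) _ = checked (hook 2 m)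
regular (hook 3 m) _ = checked (hook 3 m)
regular (rect (suc (suc (suc (suc _)))) _) (s≤s (s≤s (s≤s ())))
regular (hook (suc (suc (suc (suc _)))) _) (s≤s (s≤s (s≤s ())))

-- Values of positions from the values of their options

module _ {A B : Set} {P : A → B → Set} where

  witnesses : ∀ {xs} → All (∃ ∘ P) xs → List B
  witnesses = All.reduce proj₁

  ∈-witnesses⁺ : ∀ {x xs} (pxs : All (∃ ∘ P) xs) → x ∈ xs → ∃[ y ] P x y × y ∈ witnesses pxs
  ∈-witnesses⁺ ((y , Pxy) ∷ _) (here refl) = y , Pxy , here refl
  ∈-witnesses⁺ (_ ∷ pxs)       (there x∈)  with ∈-witnesses⁺ pxs x∈
  ... | y , Pxy , y∈ = y , Pxy , there y∈

  ∈-witnesses⁻ : ∀ {y xs} (pxs : All (∃ ∘ P) xs) → y ∈ witnesses pxs → ∃[ x ] P x y × x ∈ xs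
  ∈-witnesses⁻ ((_ , Pxy) ∷ _) (here refl) = _ , Pxy , here refl
  ∈-witnesses⁻ (_ ∷ pxs)       (there y∈)  with ∈-witnesses⁻ pxs y∈
  ... | x , Pxy , x∈ = x , Pxy , there x∈

  map-witnesses : ∀ {C : Set} {f : A → C} {g : B → C} → (∀ {x y} → P x y → g y ≡ f x) →
    ∀ {xs} (pxs : All (∃ ∘ P) xs) → map g (witnesses pxs) ≡ map f xs
  map-witnesses g≡f []                = refl
  map-witnesses g≡f ((_ , Pxy) ∷ pxs) = cong₂ _∷_ (g≡f Pxy) (map-witnesses g≡f pxs)

HasValue : Pos → Value → Set
HasValue p v = proj₁ v ≡ kind p
             × SpragueGrundy Queen ⟦ p ⟧ (normal v)
             × MisèreGrundy Queen ⟦ p ⟧ (misère v)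

module _ {p} (valued : All (∃ ∘ HasValue) (options p)) where

  private
    vs : List Value
    vs = witnesses valued

  option-value : ∀ ν → Move Queen ⟦ p ⟧ ν →
    ∃[ v ] SpragueGrundy Queen ν (normal v) × MisèreGrundy Queen ν (misère v) × v ∈ vs
  option-value ν move with options-complete p move
  ... | q , q∈ , refl with ∈-witnesses⁺ valued q∈
  ...   | v , (_ , sg , mg) , v∈ = v , sg , mg , v∈

  option-of-value : ∀ {v} → v ∈ vs →
    ∃[ ν ] Move Queen ⟦ p ⟧ ν × SpragueGrundy Queen ν (normal v) × MisèreGrundy Queen ν (misère v)
  option-of-value v∈ with ∈-witnesses⁻ valued v∈
  ... | q , (_ , sg , mg) , q∈ = ⟦ q ⟧ , options-sound p q∈ , sg , mg

  sg-by-mex : ∀ {t} → IsMex (_∈ map normal vs) t → SpragueGrundy Queen ⟦ p ⟧ t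
  sg-by-mex t-mex = mex
    (λ ν m → normal (proj₁ (option-value ν m)))
    (λ ν m → proj₁ (proj₂ (option-value ν m)))
    (mex-resp-⇔ (λ w → mk⇔ image⁺ image⁻) t-mex)
    where
    image⁺ : ∀ {w} → w ∈ map normal vs → Image Queen ⟦ p ⟧ _ w
    image⁺ w∈ with ∈-map⁻ normal w∈
    ... | v , v∈ , refl with option-of-value v∈
    -- `option-value` may reach this position through another entry of the list than `v∈` does;
    -- uniqueness of values identifies the two.
    ...   | ν , m , sg , _ = ν , m , sg-unique (proj₁ (proj₂ (option-value ν m))) sg
    image⁻ : ∀ {w} → Image Queen ⟦ p ⟧ _ w → w ∈ map normal vs
    image⁻ (ν , m , refl) = ∈-map⁺ normal (proj₂ (proj₂ (proj₂ (option-value ν m))))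

  mg-by-mex : ∀ {ℓ} → 0 < length (options p) → IsMex (_∈ map misère vs) ℓ → MisèreGrundy Queen ⟦ p ⟧ ℓ
  mg-by-mex some ℓ-mex = mex
    (option⇒¬terminal p some)
    (λ ν m → misère (proj₁ (option-value ν m)))
    (λ ν m → proj₁ (proj₂ (proj₂ (option-value ν m))))
    (mex-resp-⇔ (λ w → mk⇔ image⁺ image⁻) ℓ-mex)
    where
    image⁺ : ∀ {w} → w ∈ map misère vs → Image Queen ⟦ p ⟧ _ w
    image⁺ w∈ with ∈-map⁻ misère w∈
    ... | v , v∈ , refl with option-of-value v∈
    ...   | ν , m , _ , mg = ν , m , mg-unique (proj₁ (proj₂ (proj₂ (option-value ν m)))) mg
    image⁻ : ∀ {w} → Image Queen ⟦ p ⟧ _ w → w ∈ map misère vs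
    image⁻ (ν , m , refl) = ∈-map⁺ misère (proj₂ (proj₂ (proj₂ (option-value ν m))))

  consistent⇒value : Consistent (kind p) (map kind (options p)) → ∃ (HasValue p)
  consistent⇒value consistent@(_ , _ , some)
    with mex-values (kind p) vs (subst (Consistent (kind p)) (sym (map-witnesses proj₁ valued)) consistent)
  ... | k , n-mex , m-mex = (kind p , k) , refl , sg-by-mex n-mex ,
    mg-by-mex (subst (0 <_) (length-map kind (options p)) some) m-mex

-- Well-founded recursion on `size`. `Consistent` relates only predicted kinds; once the predictions
-- for the options are known to be true, it makes the one for `p` true.
value : ∀ p → width p ≤ 3 → ∃ (HasValue p)
value p p≤3 = go p p≤3 (<-wellFounded (size p))
  where
  go : ∀ p → width p ≤ 3 → Acc _<_ (size p) → ∃ (HasValue p)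
  go p p≤3 (acc rec) with proj₁ (regular p p≤3)
  -- At [1] the normal value is the mex of the empty set and the misère value is the default 1.
  ... | inj₁ refl = (⟨0,1⟩ , 0) , refl ,
    sg-by-mex {rect 0 0} [] ((λ ()) , λ _ _ → z≤n) ,
    terminal (no-options⇒terminal (rect 0 0) refl)
  ... | inj₂ consistent = consistent⇒value
    (All.map (λ {q} (q≤p , q<p) → go q (≤-trans q≤p p≤3) (rec q<p)) (options-smaller p))
    consistent

-- Positions of the games in the family

hook-at : ∀ {c m} i j → 𝕐⁺ (⟦ hook c m ⟧ [ i , j ]) →
  ∃[ q ] width q ≤ c × ⟦ hook c m ⟧ [ i , j ] ≡ ⟦ q ⟧
hook-at {c} {m} (suc i) j ne with rect-nonempty {c} {7 + m} {suc i} {j} ne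
... | i≤ , j≤c = rect (c ∸ j) (7 + m ∸ suc i) , m∸n≤m c j , rect-shift i≤ j≤c
hook-at {c} {m} zero j ne with m≤n⇒m<n∨m≡n (hook-nonempty {c} {m} {j} ne)
... | inj₁ (s≤s j≤c) = hook (c ∸ j) m , m∸n≤m c j , hook-shift j≤c
... | inj₂ refl      = rect 0 0 , z≤n , hook-corner c

start : ∀ {λ′} → S₂ λ′ → ∃[ p ] width p ≤ 3 × λ′ ≡ ⟦ p ⟧
-- [5,4^k] is `hook 3 m` with m = k ∸ 7; this is where k ≥ 7 enters.
start (ne , k , k≥7 , i , j , refl) with k ∸ 7 | m+[n∸m]≡n k≥7
... | m | refl = hook-at {3} {m} i j ne

position : ∀ p {x} → width p ≤ 3 → PositionOf Queen ⟦ p ⟧ x → ∃[ q ] width q ≤ 3 × x ≡ ⟦ q ⟧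
position p p≤3 ε = p , p≤3 , refl
position p p≤3 (m ◅ ms) with options-complete p m
... | q , q∈ , refl = position q (≤-trans (proj₁ (All.lookup (options-smaller p) q∈)) p≤3) ms

family-position : ∀ {λ′ x} → S₂ λ′ → PositionOf Queen λ′ x → ∃[ p ] width p ≤ 3 × x ≡ ⟦ p ⟧
family-position s reach with start s
... | p , p≤3 , refl = position p p≤3 reach

-- A capped value below 2 is exact, so the kind alone fixes the type.
reads⇒position : ∀ {t ℓ} p → width p ≤ 3 → t < 2 → ℓ < 2 → Reads t ℓ p →
  _is⟨_,_⟩-position Queen ⟦ p ⟧ t ℓ
reads⇒position p p≤3 t<2 ℓ<2 (refl , refl) with value p p≤3
... | v , refl , sg , mg =
  subst (SpragueGrundy Queen ⟦ p ⟧) (sym (cap-injective t<2 (sym (cap-normal v)))) sg ,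
  subst (MisèreGrundy Queen ⟦ p ⟧) (sym (cap-injective ℓ<2 (sym (cap-misère v)))) mg

position⇒reads : ∀ {t ℓ} p → width p ≤ 3 → _is⟨_,_⟩-position Queen ⟦ p ⟧ t ℓ → Reads (cap t) (cap ℓ) p
position⇒reads p p≤3 (sg , mg) with value p p≤3
... | v , refl , sg′ , mg′ =
  trans (sym (cap-normal v)) (cong cap (sg-unique sg′ sg)) ,
  trans (sym (cap-misère v)) (cong cap (mg-unique mg′ mg))

-- The four properties of the family

tame : QueenOnS₂ Has Tame
tame λ′ s x reach with family-position s reach
... | p , p≤3 , refl with value p p≤3
...   | (⟨0,1⟩ , _) , _ , is = inj₁ is
...   | (⟨1,0⟩ , _) , _ , is = inj₂ (inj₁ is)
...   | (⟨0,0⟩ , _) , _ , is = inj₂ (inj₂ (0 , is))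
...   | (⟨1,1⟩ , _) , _ , is = inj₂ (inj₂ (1 , is))
...   | (⟨k,k⟩ , k) , _ , is = inj₂ (inj₂ (2 + k , is))

option-width : ∀ p {q} → width p ≤ 3 → q ∈ options p → width q ≤ 3
option-width p p≤3 q∈ = ≤-trans (proj₁ (All.lookup (options-smaller p) q∈)) p≤3

moveTo : ∀ {t ℓ} p → width p ≤ 3 → t < 2 → ℓ < 2 → Any (Reads t ℓ) (options p) →
  MoveTo⟨_,_⟩ Queen t ℓ ⟦ p ⟧
moveTo p p≤3 t<2 ℓ<2 some with find some
... | q , q∈ , reads = ⟦ q ⟧ , options-sound p q∈ ,
  reads⇒position q (option-width p p≤3 q∈) t<2 ℓ<2 reads

¬moveTo : ∀ {t ℓ} p → width p ≤ 3 → All (λ q → ¬ Reads (cap t) (cap ℓ) q) (options p) →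
  ¬ MoveTo⟨_,_⟩ Queen t ℓ ⟦ p ⟧
¬moveTo p p≤3 none (ν , m , is) with options-complete p m
... | q , q∈ , refl = All.lookup none q∈ (position⇒reads q (option-width p p≤3 q∈) is)

-- The replies are read off the check in `SwappedReturns`; its exemption for an option without moves
-- is the terminal case, excluded by hypothesis.
returnable : QueenOnS₂ Has Returnable
returnable λ′ s x reach y m ¬end with family-position s reach
... | p , p≤3 , refl with options-complete p m
...   | q , q∈ , refl =
  (λ is → answer (s≤s z≤n) ≤-refl (proj₁ returns (position⇒reads p p≤3 is))) ,
  (λ is → answer ≤-refl (s≤s z≤n) (proj₂ returns (position⇒reads p p≤3 is)))
  where
  returns : SwappedReturns p
  returns = proj₂ (regular p p≤3)
  answer : ∀ {t ℓ} → t < 2 → ℓ < 2 → Returns t ℓ p → MoveTo⟨_,_⟩ Queen t ℓ ⟦ q ⟧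
  answer t<2 ℓ<2 r with All.lookup r q∈
  ... | inj₁ none = contradiction (no-options⇒terminal q none) ¬end
  ... | inj₂ some = moveTo q (option-width p p≤3 q∈) t<2 ℓ<2 some

-- [5,4^7] has the option [1], of type (0,1), but none of type (1,0).
¬miserable : QueenOnS₂ HasNot Miserable
¬miserable = ⟦ p ⟧ , (⟦⟧-nonempty p , 7 , ≤-refl , 0 , 0 , refl) , refute
  where
  p : Pos
  p = hook 3 0
  refute : ¬ Miserable Queen ⟦ p ⟧
  refute miserable with miserable ⟦ p ⟧ ε
  ... | inj₁ (inj₁ is) = contradiction (position⇒reads p ≤-refl is) (λ { (() , _) })
  ... | inj₁ (inj₂ is) = contradiction (position⇒reads p ≤-refl is) (λ { (() , _) })
  ... | inj₂ (inj₁ ¬to) = ¬to (inj₁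
    (moveTo p ≤-refl (s≤s z≤n) ≤-refl (from-yes (any? (reads? 0 1) (options p)))))
  ... | inj₂ (inj₂ (_ , to⟨1,0⟩)) =
    ¬moveTo p ≤-refl (from-yes (All.all? (λ q → ¬? (reads? 1 0 q)) (options p))) to⟨1,0⟩

-- [2^3] has type (0,1) and its option [2^2] has type (2,2).
¬forced : QueenOnS₂ HasNot Forced
-- Removing 5 of the 8 rows and 2 columns turns [5,4^7] into [2^3].
¬forced = ⟦ p ⟧ , (⟦⟧-nonempty p , 7 , ≤-refl , 5 , 2 , refl) , refute
  where
  p q : Pos
  p = rect 1 2
  q = rect 1 1
  refute : ¬ Forced Queen ⟦ p ⟧
  refute forced = contradiction
    (position⇒reads q (s≤s z≤n)
      (proj₁ (forced ⟦ p ⟧ ε ⟦ q ⟧ (options-sound p (there (here refl))))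
        (reads⇒position p (s≤s z≤n) (s≤s z≤n) ≤-refl (refl , refl))))
    (λ { (() , _) })

theorem4p13 : (QueenOnS₂ Has Tame × QueenOnS₂ HasNot Miserable)
    × (QueenOnS₂ Has Returnable × QueenOnS₂ HasNot Forced)
theorem4p13 = (tame , ¬miserable) , (returnable , ¬forced)
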